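{- Let $G$ be a digraph rooted at $v$ such that the induced subdigraph $G[V(G)\setminus\{v\}]$ is strongly connected and $G$ has no non-trivial dominators. Then the Kirchhoff polynomial $\kappa(G)$ is prime.
   Context: Digraphs are finite directed graphs without loops; parallel edges are allowed. An arborescence of a digraph $G=(V,E)$ is a subdigraph $A$ spanning all of $V$ with a root vertex from which every vertex is reachable along a unique directed path in $A$ (a rooted directed spanning tree with edges directed away from the root). Arborescences are identified with their edge sets. Let $\mathsf{arb}(G)$ be the set of all arborescences of $G$ (over all roots). Each edge $e\in E$ is regarded as a variable, distinct edges being distinct variables. The Kirchhoff polynomial is $\kappa(G)=\sum_{A\in\mathsf{arb}(G)}\prod_{e\in A}e\in\mathbb{Q}[e : e\in E]$; for a one-vertex digraph $\kappa(G)=1$. A polynomial is called prime if it has only trivial factors, i.e. whenever it equals $P\cdot Q$, one of $P,Q$ is a constant (with this convention the constant $1$ counts as prime). $G$ is rooted at $v$ if $v$ has no incoming edges and every other vertex is reachable from $v$ by a directed path. If $G$ is rooted at $v$, a vertex $u$ dominates a vertex $w$ if all directed paths from $v$ to $w$ go through $u$; $\mathsf{dom}_G(u)$ denotes the set of all vertices dominated by $u$ (so $u\in\mathsf{dom}_G(u)$). A vertex $u$ is a non-trivial dominator if $u\neq v$ and $\mathsf{dom}_G(u)\neq\{u\}$. A digraph is strongly connected if any two of its vertices are reachable from each other by directed paths. -}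

module Defs where

open import Data.Bool.Base using (if_then_else_)
open import Data.Fin.Base using (Fin)
open import Data.Fin.Properties using (any?; all?; injective⇒≤) renaming (_≟_ to _≟ᶠ_)
open import Data.Fin.Subset using (Subset; inside; outside; _∈_)
open import Data.Fin.Subset.Properties using (_∈?_)
open import Data.List.Base
  using (List; []; _∷_; _++_; _∷ʳ_; [_]; map; foldr; filter; length; lookup; allFin;
         cartesianProductWith; initLast; _∷ʳ′_)
open import Data.List.Membership.Propositional using () renaming (_∈_ to _∈ₗ_)
import Data.List.Membership.DecPropositional as DecMembership
open import Data.List.Properties using (length-map; ∷ʳ-injectiveʳ)
open import Data.List.Relation.Unary.All.Properties using (¬Any⇒All¬)
open import Data.List.Relation.Unary.Any using (here; there)
open import Data.List.Relation.Unary.AllPairs using ([]; _∷_)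
open import Data.List.Relation.Unary.Unique.Propositional using (Unique)
import Data.List.Relation.Unary.All as All
import Data.List.Membership.Propositional.Properties as ∈ₗ
open import Data.Nat.Base using (ℕ; zero; suc; _≤_; z≤n; s≤s) renaming (_+_ to _+ℕ_)
open import Data.Nat.Properties using (≤-trans; n≤1+n) renaming (_≟_ to _≟ℕ_)
open import Data.Product using (∃; ∃!; _×_; _,_)
open import Data.Rational.Base using (ℚ; 0ℚ; 1ℚ; _+_; _*_)
open import Data.Sum.Base using (_⊎_; inj₁; inj₂)
open import Data.Vec.Base using (Vec; []; _∷_; replicate; zipWith; tabulate)
open import Data.Vec.Properties using () renaming (≡-dec to ≡-decᵛ)
open import Level using (0ℓ)
open import Relation.Binary.PropositionalEquality using (_≡_; _≢_; refl; sym; trans; cong; subst)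
open import Relation.Nullary using (¬_; Dec; yes; no; does; contradiction)
open import Relation.Nullary.Decidable using (map′; _×-dec_; _⊎-dec_; ¬?; _→-dec_)
open import Relation.Unary using (Pred; U; _≐_; ｛_｝)

Monomial : ℕ → Set
Monomial m = Vec ℕ m

-- A polynomial is written as a list of terms, not necessarily reduced; two
-- such expressions denote the same polynomial when all coefficients agree.
Polynomial : ℕ → Set
Polynomial m = List (ℚ × Monomial m)

module _ {m : ℕ} where

  coefficient : Polynomial m → Monomial m → ℚ
  coefficient []            α = 0ℚ
  coefficient ((c , β) ∷ p) α =
    (if does (≡-decᵛ _≟ℕ_ β α) then c else 0ℚ) + coefficient p α

  infix 4 _≈ₚ_
  _≈ₚ_ : Polynomial m → Polynomial m → Set
  p ≈ₚ q = ∀ α → coefficient p α ≡ coefficient q α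

  const : ℚ → Polynomial m
  const c = [ c , replicate m 0 ]

  var : Fin m → Polynomial m
  var e = [ 1ℚ , tabulate (λ f → if does (e ≟ᶠ f) then 1 else 0) ]

  infixl 6 _+ₚ_
  _+ₚ_ : Polynomial m → Polynomial m → Polynomial m
  _+ₚ_ = _++_

  infixl 7 _*ₚ_
  _*ₚ_ : Polynomial m → Polynomial m → Polynomial m
  _*ₚ_ = cartesianProductWith λ (c , α) (d , β) → c * d , zipWith _+ℕ_ α β

  sumₚ : List (Polynomial m) → Polynomial m
  sumₚ = foldr _+ₚ_ (const 0ℚ)

  productₚ : List (Polynomial m) → Polynomial m
  productₚ = foldr _*ₚ_ (const 1ℚ)

  IsConstant : Polynomial m → Set
  IsConstant p = ∃ λ c → p ≈ₚ const c

  -- Constants are not excluded: 1 counts as prime.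
  IsPrime : Polynomial m → Set
  IsPrime k = ∀ p q → k ≈ₚ p *ₚ q → IsConstant p ⊎ IsConstant q

record Digraph : Set where
  field
    order    : ℕ
    size     : ℕ
    source   : Fin size → Fin order
    target   : Fin size → Fin order
    loopless : ∀ e → source e ≢ target e

  Vertex : Set
  Vertex = Fin order

  Edge : Set
  Edge = Fin size

  -- es is a directed path from u to w all of whose edges satisfy R.
  -- Repeated vertices are allowed.
  IsPath : Pred Edge 0ℓ → Vertex → Vertex → Pred (List Edge) 0ℓ
  IsPath R u w []       = u ≡ w
  IsPath R u w (e ∷ es) = R e × source e ≡ u × IsPath R (target e) w es

  Reachable : Pred Edge 0ℓ → Vertex → Vertex → Set
  Reachable R u w = ∃ (IsPath R u w)

  vertices : Vertex → List Edge → List Vertex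
  vertices u es = u ∷ map target es

  RootedAt : Vertex → Set
  RootedAt v = (∀ e → target e ≢ v) × (∀ w → w ≢ v → Reachable U v w)

  -- The subdigraph induced by S is handled through its edges: a path between
  -- vertices of S lies in it exactly when all its edges have both ends in S.
  InducedEdge : Pred Vertex 0ℓ → Pred Edge 0ℓ
  InducedEdge S e = S (source e) × S (target e)

  InducedStronglyConnected : Pred Vertex 0ℓ → Set
  InducedStronglyConnected S = ∀ u w → S u → S w → Reachable (InducedEdge S) u w

  dom : (v u : Vertex) → Pred Vertex 0ℓ
  dom v u w = ∀ es → IsPath U v w es → u ∈ₗ vertices v es

  NonTrivialDominator : (v u : Vertex) → Set
  NonTrivialDominator v u = u ≢ v × ¬ (dom v u ≐ ｛ u ｝)

  -- A is the edge set of a subdigraph containing all vertices. Since paths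
  -- may repeat vertices, uniqueness of the path from r to every vertex also
  -- rules out cycles, in particular edges entering r.
  IsArborescenceAt : Subset size → Vertex → Set
  IsArborescenceAt A r = ∀ w → ∃! _≡_ (IsPath (_∈ A) r w)

  IsArborescence : Subset size → Set
  IsArborescence A = ∃ (IsArborescenceAt A)

  -- Being an arborescence is decidable: it amounts to reachability from r,
  -- no edge entering r and at most one edge entering any vertex.

  module _ {R : Pred Edge 0ℓ} where

    snoc-path : ∀ {u} es e → IsPath R u (source e) es → R e → IsPath R u (target e) (es ∷ʳ e)
    snoc-path []       e p              Re = Re , sym p , refl
    snoc-path (f ∷ es) e (Rf , eq , p) Re = Rf , eq , snoc-path es e p Re

    unsnoc-path : ∀ {u w} es e → IsPath R u w (es ∷ʳ e) →
                  IsPath R u (source e) es × R e × target e ≡ w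
    unsnoc-path []       e (Re , eq , p) = sym eq , Re , p
    unsnoc-path (f ∷ es) e (Rf , eq , p) =
      let q , Re , eq′ = unsnoc-path es e p in (Rf , eq , q) , Re , eq′

    open DecMembership (_≟ᶠ_ {order}) using () renaming (_∈?_ to _∈ₗ?_)

    suffix-path : ∀ {x u w} es → IsPath R x w es → Unique (vertices x es) → u ∈ₗ vertices x es →
                  ∃ λ fs → IsPath R u w fs × Unique (vertices u fs)
    suffix-path es       p           un       (here refl) = es , p , un
    suffix-path (e ∷ es) (_ , _ , p) (_ ∷ un) (there u∈)  = suffix-path es p un u∈

    simple-path : ∀ {u w} es → IsPath R u w es →
                  ∃ λ fs → IsPath R u w fs × Unique (vertices u fs)
    simple-path []       p = [] , p , All.[] ∷ []
    simple-path {u} (e ∷ es) (Re , eq , p) with simple-path es p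
    ... | fs , q , un with u ∈ₗ? vertices (target e) fs
    ...   | yes u∈ = suffix-path fs q un u∈
    ...   | no  u∉ = e ∷ fs , (Re , eq , q) , ¬Any⇒All¬ _ u∉ ∷ un

  unique⇒length≤ : ∀ {n} {xs : List (Fin n)} → Unique xs → length xs ≤ n
  unique⇒length≤ {xs = xs} un = injective⇒≤ (lookup-inj un)
    where
    lookup-inj : ∀ {n} {xs : List (Fin n)} → Unique xs → ∀ {i j} →
                 lookup xs i ≡ lookup xs j → i ≡ j
    lookup-inj (x∉ ∷ un) {Fin.zero}  {Fin.zero}  eq = refl
    lookup-inj (x∉ ∷ un) {Fin.zero}  {Fin.suc j} eq = contradiction eq (All.lookup x∉ (∈ₗ.∈-lookup j))
    lookup-inj (x∉ ∷ un) {Fin.suc i} {Fin.zero}  eq = contradiction (sym eq) (All.lookup x∉ (∈ₗ.∈-lookup i))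
    lookup-inj (x∉ ∷ un) {Fin.suc i} {Fin.suc j} eq = cong Fin.suc (lookup-inj un eq)

  module _ (A : Subset size) where

    shortPath? : ∀ k u w → Dec (∃ λ es → IsPath (_∈ A) u w es × length es ≤ k)
    shortPath? zero    u w = map′ (λ eq → [] , eq , z≤n) (λ { ([] , eq , _) → eq }) (u ≟ᶠ w)
    shortPath? (suc k) u w =
      map′ (λ { (inj₁ eq) → [] , eq , z≤n
              ; (inj₂ (e , e∈ , eq , es , p , l)) → e ∷ es , (e∈ , eq , p) , s≤s l })
           (λ { ([] , eq , _) → inj₁ eq
              ; (e ∷ es , (e∈ , eq , p) , s≤s l) → inj₂ (e , e∈ , eq , es , p , l) })
           (u ≟ᶠ w ⊎-dec
            any? (λ e → e ∈? A ×-dec (source e ≟ᶠ u ×-dec shortPath? k (target e) w)))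

    reachable? : ∀ u w → Dec (Reachable (_∈ A) u w)
    reachable? u w = map′ (λ (es , p , _) → es , p) shorten (shortPath? order u w)
      where
      shorten : Reachable (_∈ A) u w → ∃ λ es → IsPath (_∈ A) u w es × length es ≤ order
      shorten (es , p) =
        let fs , q , un = simple-path es p in
        fs , q , ≤-trans (n≤1+n _)
          (subst (λ l → suc l ≤ order) (length-map target fs) (unique⇒length≤ un))

    LocalArborescenceAt : Vertex → Set
    LocalArborescenceAt r =
      (∀ w → Reachable (_∈ A) r w) ×
      (∀ e → e ∈ A → target e ≢ r) ×
      (∀ e f → e ∈ A → f ∈ A → target e ≡ target f → e ≡ f)

    local⇒arborescence : ∀ {r} → LocalArborescenceAt r → IsArborescenceAt A r
    local⇒arborescence {r} (reach , noIn , oneIn) w =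
      let es , p = reach w in es , p , λ {fs} q → unique (length es) es fs p q refl
      where
      length-∷ʳ : (xs : List Edge) (x : Edge) → length (xs ∷ʳ x) ≡ suc (length xs)
      length-∷ʳ []       x = refl
      length-∷ʳ (_ ∷ xs) x = cong suc (length-∷ʳ xs x)

      suc-inj : ∀ {a b : ℕ} → suc a ≡ suc b → a ≡ b
      suc-inj refl = refl

      unique : ∀ k {w} es fs → IsPath (_∈ A) r w es → IsPath (_∈ A) r w fs →
               length es ≡ k → es ≡ fs
      unique k es fs p q l with initLast es | initLast fs
      unique k _ _ p q l | []        | []        = refl
      unique k _ _ p q l | []        | fs ∷ʳ′ f  =
        let _ , f∈ , eq = unsnoc-path fs f q in contradiction (trans eq (sym p)) (noIn f f∈)
      unique k _ _ p q l | es ∷ʳ′ e  | []        =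
        let _ , e∈ , eq = unsnoc-path es e p in contradiction (trans eq (sym q)) (noIn e e∈)
      unique zero _ _ p q l | es ∷ʳ′ e | fs ∷ʳ′ f =
        contradiction (trans (sym (length-∷ʳ es e)) l) λ ()
      unique (suc k) _ _ p q l | es ∷ʳ′ e | fs ∷ʳ′ f
        with unsnoc-path es e p | unsnoc-path fs f q
      ... | p′ , e∈ , eq | q′ , f∈ , eq′ with oneIn e f e∈ f∈ (trans eq (sym eq′))
      ... | refl = cong (_∷ʳ e)
              (unique k es fs p′ q′ (suc-inj (trans (sym (length-∷ʳ es e)) l)))

    arborescence⇒local : ∀ {r} → IsArborescenceAt A r → LocalArborescenceAt r
    arborescence⇒local {r} arb = reach , noIn , oneIn
      where
      reach : ∀ w → Reachable (_∈ A) r w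
      reach w = let es , p , _ = arb w in es , p

      unique : ∀ {w es fs} → IsPath (_∈ A) r w es → IsPath (_∈ A) r w fs → es ≡ fs
      unique {w} p q = let _ , _ , u = arb w in trans (sym (u p)) (u q)

      ∷ʳ≢[] : (xs : List Edge) (x : Edge) → xs ∷ʳ x ≢ []
      ∷ʳ≢[] []      x ()
      ∷ʳ≢[] (_ ∷ _) x ()

      noIn : ∀ e → e ∈ A → target e ≢ r
      noIn e e∈ eq =
        let es , p = reach (source e) in
        ∷ʳ≢[] es e (unique (snoc-path es e p e∈) (sym eq))

      oneIn : ∀ e f → e ∈ A → f ∈ A → target e ≡ target f → e ≡ f
      oneIn e f e∈ f∈ eq =
        let es , p = reach (source e)
            fs , q = reach (source f) in
        ∷ʳ-injectiveʳ es fs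
          (unique (snoc-path es e p e∈)
                  (subst (λ w → IsPath (_∈ A) r w (fs ∷ʳ f)) (sym eq) (snoc-path fs f q f∈)))

    isArborescenceAt? : ∀ r → Dec (IsArborescenceAt A r)
    isArborescenceAt? r = map′ local⇒arborescence arborescence⇒local
      (all? (reachable? r) ×-dec
       (all? (λ e → e ∈? A →-dec ¬? (target e ≟ᶠ r)) ×-dec
        all? (λ e → all? (λ f →
          e ∈? A →-dec (f ∈? A →-dec (target e ≟ᶠ target f →-dec e ≟ᶠ f))))))

    isArborescence? : Dec (IsArborescence A)
    isArborescence? = any? isArborescenceAt?

subsets : ∀ m → List (Subset m)
subsets zero    = [ [] ]
subsets (suc m) = map (outside ∷_) (subsets m) ++ map (inside ∷_) (subsets m)

module _ (G : Digraph) where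
  open Digraph G

  arborescences : List (Subset size)
  arborescences = filter isArborescence? (subsets size)

  κ : Polynomial size
  κ = sumₚ (map (λ A → productₚ (map var (filter (_∈? A) (allFin size)))) arborescences)

{-# OPTIONS --safe #-}

-- Suppose κ = p * q. In every monomial of κ the edges entering a given vertex have
-- total degree at most 1, and leading terms multiply, so all edges entering a vertex
-- occur in only one of p and q: the vertices other than v fall into two classes. As
-- p and q share no variables, the monomials of κ are exactly the products of a monomial
-- of p with one of q. Hence arborescences can be exchanged: keeping the edges of one
-- entering the first class and the edges of another entering the second class gives
-- again an arborescence. If both classes are inhabited, strong connectivity provides a
-- cycle outside v meeting both. Grow a tree on a vertex set S from v as long as such a
-- cycle remains outside S. Once no further growth is possible, every exit from S
-- leads onto every such cycle. Exits into both classes contradict the exchange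
-- property, and exits into one class only contradict the absence of dominators.
module Submission where

open import Defs
open import Algebra.Apartness.Properties.HeytingCommutativeRing using (x#0y#0→xy#0)
open import Algebra.Bundles using (CommutativeMonoid)
import Algebra.Properties.CommutativeSemigroup as CommutativeSemigroupProperties
open import Data.Bool.Base using (Bool; true; false; if_then_else_)
import Data.Bool.Properties as Bool
open import Data.Empty using (⊥; ⊥-elim)
open import Data.Fin.Base using (Fin; zero; suc)
open import Data.Fin.Properties using (any?; suc-injective) renaming (_≟_ to _≟ᶠ_)
open import Data.Fin.Subset using (Subset; inside; outside) renaming (_∈_ to _∈ˢ_; _∉_ to _∉ˢ_)
open import Data.Fin.Subset.Properties using () renaming (_∈?_ to _∈ˢ?_)
open import Data.List.Base
  using (List; []; _∷_; _++_; _∷ʳ_; [_]; map; foldr; filter; length; deduplicate; allFin)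
import Data.List.Extrema as Extrema
open import Data.List.Membership.Propositional using (_∈_; _∉_; lose)
open import Data.List.Membership.Propositional.Properties
  using (∈-++⁺ˡ; ∈-++⁺ʳ; ∈-++⁻; ∈-∃++; ∈-map⁺; ∈-map⁻; ∈-filter⁺; ∈-filter⁻; ∈-deduplicate⁺; ∈-allFin)
import Data.List.Membership.DecPropositional as DecMembership
open import Data.List.Properties using (map-++; ++-identityʳ; ++-identityʳ-unique)
open import Data.List.Relation.Binary.Subset.Propositional using (_⊆_)
open import Data.List.Relation.Unary.All using (All; []; _∷_)
import Data.List.Relation.Unary.All as All
import Data.List.Relation.Unary.All.Properties as All
open import Data.List.Relation.Unary.AllPairs using ([]; _∷_)
import Data.List.Relation.Unary.AllPairs.Properties as AllPairs
open import Data.List.Relation.Unary.Any as Any using (Any; here; there)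
open import Data.List.Relation.Unary.Unique.DecPropositional.Properties using (deduplicate-!)
open import Data.List.Relation.Unary.Unique.Propositional using (Unique)
open import Data.List.Relation.Unary.Unique.Propositional.Properties using (allFin⁺; filter⁺)
open import Data.Nat.Base using (ℕ; zero; suc; z≤n; s≤s⁻¹; _∸_)
  renaming (_+_ to _+ℕ_; _≤_ to _≤ℕ_; _<_ to _<ℕ_)
import Data.Nat.Properties as ℕ
open import Data.Product using (∃; ∃₂; _×_; _,_; proj₁; proj₂)
open import Data.Rational.Base using (ℚ; 0ℚ; 1ℚ; _+_; _*_; _≤_; _<_)
import Data.Rational.Properties as ℚ
open import Data.Sum.Base as Sum using (_⊎_; inj₁; inj₂)
open import Data.Vec.Base using (Vec; []; _∷_; head; tail; replicate; zipWith; lookup; tabulate)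
open import Data.Vec.Properties
  using (lookup-zipWith; lookup-replicate; lookup∘tabulate; tabulate∘lookup; tabulate-cong;
         lookup⇒[]=; []=⇒lookup)
  renaming (≡-dec to ≡-decᵛ)
import Data.Vec.Relation.Binary.Lex.Strict as Lex
open import Function.Base using (_∘_; id)
open import Level using (0ℓ)
open import Relation.Binary.Bundles using (TotalOrder)
open import Relation.Binary.PropositionalEquality
  using (_≡_; _≢_; refl; sym; trans; cong; cong₂; subst; module ≡-Reasoning)
open import Relation.Nullary using (¬_; Dec; yes; no; does; contradiction)
open import Relation.Nullary.Decidable using (_×-dec_; ¬?; dec-true; dec-false; decidable-stable; from-yes)
open import Relation.Unary using (Pred; U)

-- Supports of products

Σ[_] : {A : Set} → List A → (A → ℚ) → ℚ
Σ[ D ] f = foldr (λ x s → f x + s) 0ℚ D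

module _ {A : Set} where

  Σ-cong : ∀ {f g : A → ℚ} D → (∀ x → f x ≡ g x) → Σ[ D ] f ≡ Σ[ D ] g
  Σ-cong []      eq = refl
  Σ-cong (x ∷ D) eq = cong₂ _+_ (eq x) (Σ-cong D eq)

  Σ-zero : ∀ {f : A → ℚ} D → (∀ {x} → x ∈ D → f x ≡ 0ℚ) → Σ[ D ] f ≡ 0ℚ
  Σ-zero []      eq = refl
  Σ-zero (x ∷ D) eq = cong₂ _+_ (eq (here refl)) (Σ-zero D (eq ∘ there))

  Σ-+ : ∀ (f g : A → ℚ) D → Σ[ D ] (λ x → f x + g x) ≡ Σ[ D ] f + Σ[ D ] g
  Σ-+ f g []      = refl
  Σ-+ f g (x ∷ D) = begin
    (f x + g x) + Σ[ D ] (λ y → f y + g y) ≡⟨ cong ((f x + g x) +_) (Σ-+ f g D) ⟩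
    (f x + g x) + (Σ[ D ] f + Σ[ D ] g)    ≡⟨ interchange (f x) (g x) (Σ[ D ] f) (Σ[ D ] g) ⟩
    (f x + Σ[ D ] f) + (g x + Σ[ D ] g)    ∎
    where
    open ≡-Reasoning
    open CommutativeSemigroupProperties
      (CommutativeMonoid.commutativeSemigroup ℚ.+-0-commutativeMonoid) using (interchange)

  Σ-single : ∀ {f : A → ℚ} {D x} → Unique D → x ∈ D → (∀ {y} → y ≢ x → f y ≡ 0ℚ) → Σ[ D ] f ≡ f x
  Σ-single {f} {x ∷ D} (x∉ ∷ _) (here refl) others =
    trans (cong (f x +_) (Σ-zero D (λ y∈ → others (All.lookup x∉ y∈ ∘ sym)))) (ℚ.+-identityʳ (f x))
  Σ-single {f} {y ∷ D} {x} (y∉ ∷ un) (there x∈) others =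
    trans (cong₂ _+_ (others (All.lookup y∉ x∈)) (Σ-single un x∈ others)) (ℚ.+-identityˡ (f x))

  Σ≢0 : ∀ {f : A → ℚ} D → Σ[ D ] f ≢ 0ℚ → ∃ λ x → f x ≢ 0ℚ
  Σ≢0         []      ne = contradiction refl ne
  Σ≢0 {f = f} (x ∷ D) ne with f x ℚ.≟ 0ℚ
  ... | no  fx≢0 = x , fx≢0
  ... | yes fx≡0 = Σ≢0 D (λ eq → ne (cong₂ _+_ fx≡0 eq))

lookup-injective : ∀ {A : Set} {n} {xs ys : Vec A n} → (∀ i → lookup xs i ≡ lookup ys i) → xs ≡ ys
lookup-injective {xs = xs} {ys} eq =
  trans (sym (tabulate∘lookup xs)) (trans (tabulate-cong eq) (tabulate∘lookup ys))

infixl 6 _⊕_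
_⊕_ : ∀ {m} → Monomial m → Monomial m → Monomial m
_⊕_ = zipWith _+ℕ_

⊕-cancelˡ : ∀ {m} (α : Monomial m) {β γ} → α ⊕ β ≡ α ⊕ γ → β ≡ γ
⊕-cancelˡ α {β} {γ} eq = lookup-injective λ i → ℕ.+-cancelˡ-≡ (lookup α i) _ _
  (trans (sym (lookup-zipWith _+ℕ_ i α β)) (trans (cong (λ δ → lookup δ i) eq) (lookup-zipWith _+ℕ_ i α γ)))

module _ {m : ℕ} where

  _≟_ : (α β : Monomial m) → Dec (α ≡ β)
  _≟_ = ≡-decᵛ ℕ._≟_

  Support : Polynomial m → Monomial m → Set
  Support p α = coefficient p α ≢ 0ℚ

  support? : ∀ p α → Dec (Support p α)
  support? p α = ¬? (coefficient p α ℚ.≟ 0ℚ)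

  support-term : ∀ p {α} → Support p α → ∃ λ c → c ≢ 0ℚ × (c , α) ∈ p
  support-term []            ne = contradiction refl ne
  support-term ((c , β) ∷ p) {α} ne with coefficient p α ℚ.≟ 0ℚ
  ... | no ne′ = let d , d≢0 , d∈ = support-term p ne′ in d , d≢0 , there d∈
  ... | yes eq with β ≟ α
  ...   | yes refl = c , (λ { refl → ne (cong (0ℚ +_) eq) }) , here refl
  ...   | no _     = contradiction (cong (0ℚ +_) eq) ne

  support-∈ : ∀ p {α} → Support p α → α ∈ map proj₂ p
  support-∈ p s = let _ , _ , c∈ = support-term p s in ∈-map⁺ proj₂ c∈

  -- Defined on unreduced lists of terms, but by ⟪⟫-Σ dependent only on the coefficients.
  ⟪_⟫ : (Monomial m → ℚ) → Polynomial m → ℚ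
  ⟪ h ⟫ []            = 0ℚ
  ⟪ h ⟫ ((c , α) ∷ p) = c * h α + ⟪ h ⟫ p

  -- Like terms are collected over `D`, which may be any duplicate-free list covering the monomials
  -- of `p`, so that further monomials can be added to it.
  ⟪⟫-Σ : ∀ h p {D} → Unique D → (∀ {α} → α ∈ map proj₂ p → α ∈ D) →
         ⟪ h ⟫ p ≡ Σ[ D ] (λ δ → coefficient p δ * h δ)
  ⟪⟫-Σ h []            {D} un sub = sym (Σ-zero D (λ {δ} _ → ℚ.*-zeroˡ (h δ)))
  ⟪⟫-Σ h ((c , β) ∷ p) {D} un sub = begin
    c * h β + ⟪ h ⟫ p
      ≡⟨ cong₂ _+_ (sym head-term) (⟪⟫-Σ h p un (sub ∘ there)) ⟩
    Σ[ D ] (λ δ → at δ * h δ) + Σ[ D ] (λ δ → coefficient p δ * h δ)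
      ≡⟨ sym (Σ-+ (λ δ → at δ * h δ) (λ δ → coefficient p δ * h δ) D) ⟩
    Σ[ D ] (λ δ → at δ * h δ + coefficient p δ * h δ)
      ≡⟨ Σ-cong D (λ δ → sym (ℚ.*-distribʳ-+ (h δ) (at δ) (coefficient p δ))) ⟩
    Σ[ D ] (λ δ → (at δ + coefficient p δ) * h δ)
      ∎
    where
    open ≡-Reasoning
    at : Monomial m → ℚ
    at δ = if does (β ≟ δ) then c else 0ℚ

    head-term : Σ[ D ] (λ δ → at δ * h δ) ≡ c * h β
    head-term = trans
      (Σ-single un (sub (here refl)) λ {δ} δ≢β →
        trans (cong (λ b → (if b then c else 0ℚ) * h δ) (dec-false (β ≟ δ) (δ≢β ∘ sym))) (ℚ.*-zeroˡ (h δ)))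
      (cong (λ b → (if b then c else 0ℚ) * h β) (dec-true (β ≟ β) refl))

  ⟪⟫-single : ∀ {h} p α → (∀ {δ} → Support p δ → δ ≢ α → h δ ≡ 0ℚ) → ⟪ h ⟫ p ≡ coefficient p α * h α
  ⟪⟫-single {h} p α others = trans
    -- Prepending `α` makes the single-term sum available even when no term of `p` has this
    -- monomial.
    (⟪⟫-Σ h p (deduplicate-! _≟_ (α ∷ map proj₂ p)) (∈-deduplicate⁺ _≟_ ∘ there))
    (Σ-single (deduplicate-! _≟_ (α ∷ map proj₂ p)) (here refl) other)
    where
    other : ∀ {δ} → δ ≢ α → coefficient p δ * h δ ≡ 0ℚ
    other {δ} δ≢α with support? p δ
    ... | yes s = trans (cong (coefficient p δ *_) (others s δ≢α)) (ℚ.*-zeroʳ (coefficient p δ))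
    ... | no ¬s = trans (cong (_* h δ) (decidable-stable (coefficient p δ ℚ.≟ 0ℚ) ¬s)) (ℚ.*-zeroˡ (h δ))

  ⟪⟫≢0 : ∀ {h} p → ⟪ h ⟫ p ≢ 0ℚ → ∃ λ α → Support p α × h α ≢ 0ℚ
  ⟪⟫≢0 {h} p ne =
    let α , cα≢0 = Σ≢0 {f = λ δ → coefficient p δ * h δ} D
          (ne ∘ trans (⟪⟫-Σ h p (deduplicate-! _≟_ _) (∈-deduplicate⁺ _≟_)))
    in α , (λ eq → cα≢0 (trans (cong (_* h α) eq) (ℚ.*-zeroˡ (h α))))
         , (λ eq → cα≢0 (trans (cong (coefficient p α *_) eq) (ℚ.*-zeroʳ (coefficient p α))))
    where D = deduplicate _≟_ (map proj₂ p)

  indicator : Monomial m → Monomial m → ℚ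
  indicator γ β = if does (β ≟ γ) then 1ℚ else 0ℚ

  indicator-true : ∀ γ → indicator γ γ ≡ 1ℚ
  indicator-true γ = cong (if_then 1ℚ else 0ℚ) (dec-true (γ ≟ γ) refl)

  indicator≢0 : ∀ {γ β} → indicator γ β ≢ 0ℚ → β ≡ γ
  indicator≢0 {γ} {β} ne with β ≟ γ
  ... | yes eq = eq
  ... | no _   = contradiction refl ne

  coefficient-++ : ∀ p q γ → coefficient (p ++ q) γ ≡ coefficient p γ + coefficient q γ
  coefficient-++ []            q γ = sym (ℚ.+-identityˡ (coefficient q γ))
  coefficient-++ ((c , α) ∷ p) q γ =
    trans (cong (at +_) (coefficient-++ p q γ)) (sym (ℚ.+-assoc at (coefficient p γ) (coefficient q γ)))
    where at = if does (α ≟ γ) then c else 0ℚ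

  coefficient-term-* : ∀ c α q γ →
    coefficient (map (λ (d , β) → c * d , α ⊕ β) q) γ ≡ c * ⟪ (λ β → indicator γ (α ⊕ β)) ⟫ q
  coefficient-term-* c α []            γ = sym (ℚ.*-zeroʳ c)
  coefficient-term-* c α ((d , β) ∷ q) γ =
    trans (cong₂ _+_ (scale (does ((α ⊕ β) ≟ γ))) (coefficient-term-* c α q γ))
          (sym (ℚ.*-distribˡ-+ c (d * indicator γ (α ⊕ β)) (⟪ (λ ε → indicator γ (α ⊕ ε)) ⟫ q)))
    where
    scale : ∀ b → (if b then c * d else 0ℚ) ≡ c * (d * (if b then 1ℚ else 0ℚ))
    scale true  = cong (c *_) (sym (ℚ.*-identityʳ d))
    scale false = sym (trans (cong (c *_) (ℚ.*-zeroʳ d)) (ℚ.*-zeroʳ c))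

  -- Writing the convolution as two nested pairings lets `⟪⟫-Σ` pass from the unreduced terms of `p`
  -- and `q` to their coefficients.
  coefficient-* : ∀ p q γ →
    coefficient (p *ₚ q) γ ≡ ⟪ (λ α → ⟪ (λ β → indicator γ (α ⊕ β)) ⟫ q) ⟫ p
  coefficient-* []            q γ = refl
  coefficient-* ((c , α) ∷ p) q γ =
    trans (coefficient-++ (map (λ (d , β) → c * d , α ⊕ β) q) (p *ₚ q) γ)
          (cong₂ _+_ (coefficient-term-* c α q γ) (coefficient-* p q γ))

  support-*⁻ : ∀ p q {γ} → Support (p *ₚ q) γ →
               ∃₂ λ α β → Support p α × Support q β × α ⊕ β ≡ γ
  support-*⁻ p q {γ} s =
    let α , sα , ne = ⟪⟫≢0 p (s ∘ trans (coefficient-* p q γ))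
        β , sβ , hit = ⟪⟫≢0 q ne
    in α , β , sα , sβ , indicator≢0 hit

  -- By cancellation, the uniqueness of `α` leaves a single way to obtain `α ⊕ β`. Its coefficient
  -- is then a product of two non-zero rationals, with nothing to cancel it.
  support-*⁺ : ∀ p q {α β} → Support p α → Support q β →
               (∀ {α′ β′} → Support p α′ → Support q β′ → α′ ⊕ β′ ≡ α ⊕ β → α′ ≡ α) →
               Support (p *ₚ q) (α ⊕ β)
  support-*⁺ p q {α} {β} sα sβ unique eq = x#0y#0→xy#0 ℚ.heytingCommutativeRing sα sβ (trans (sym value) eq)
    where
    open ≡-Reasoning
    value : coefficient (p *ₚ q) (α ⊕ β) ≡ coefficient p α * coefficient q β
    value = begin
      coefficient (p *ₚ q) (α ⊕ β)
        ≡⟨ coefficient-* p q (α ⊕ β) ⟩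
      ⟪ (λ δ → ⟪ (λ ε → indicator (α ⊕ β) (δ ⊕ ε)) ⟫ q) ⟫ p
        ≡⟨ ⟪⟫-single p α (λ {δ} sδ δ≢α → decidable-stable (⟪ _ ⟫ q ℚ.≟ 0ℚ) λ ne →
             let ε , sε , hit = ⟪⟫≢0 q ne in δ≢α (unique sδ sε (indicator≢0 hit))) ⟩
      coefficient p α * ⟪ (λ ε → indicator (α ⊕ β) (α ⊕ ε)) ⟫ q
        ≡⟨ cong (coefficient p α *_) (⟪⟫-single q β (λ {ε} _ ε≢β →
             decidable-stable (indicator (α ⊕ β) (α ⊕ ε) ℚ.≟ 0ℚ) λ ne → ε≢β (⊕-cancelˡ α (indicator≢0 ne)))) ⟩
      coefficient p α * (coefficient q β * indicator (α ⊕ β) (α ⊕ β))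
        ≡⟨ cong (λ x → coefficient p α * (coefficient q β * x)) (indicator-true (α ⊕ β)) ⟩
      coefficient p α * (coefficient q β * 1ℚ)
        ≡⟨ cong (coefficient p α *_) (ℚ.*-identityʳ (coefficient q β)) ⟩
      coefficient p α * coefficient q β ∎

  constant : ∀ p → (∀ {α} → Support p α → ∀ e → lookup α e ≡ 0) → IsConstant p
  constant p zero-exponents = coefficient p 0# , equal
    where
    0# = replicate m 0
    equal : p ≈ₚ const (coefficient p 0#)
    equal α with 0# ≟ α
    ... | yes refl = sym (ℚ.+-identityʳ (coefficient p 0#))
    ... | no ne    = decidable-stable (coefficient p α ℚ.≟ 0ℚ) λ s →
      ne (lookup-injective λ e → trans (lookup-replicate e 0) (sym (zero-exponents s e)))

-- Degrees in a set of variables and leading monomials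

degree : ∀ {m} → (Fin m → Bool) → Monomial m → ℕ
degree S []      = 0
degree S (a ∷ α) = (if S zero then a else 0) +ℕ degree (S ∘ suc) α

lexOrder : ℕ → TotalOrder _ _ _
lexOrder = Lex.≤-totalOrder ℕ.<-strictTotalOrder

degree-⊕ : ∀ {m} S (α β : Monomial m) → degree S (α ⊕ β) ≡ degree S α +ℕ degree S β
degree-⊕ S []      []      = refl
degree-⊕ S (a ∷ α) (b ∷ β) with S zero
... | false = degree-⊕ (S ∘ suc) α β
... | true  = begin
  (a +ℕ b) +ℕ degree S′ (α ⊕ β)          ≡⟨ cong ((a +ℕ b) +ℕ_) (degree-⊕ S′ α β) ⟩
  (a +ℕ b) +ℕ (degree S′ α +ℕ degree S′ β) ≡⟨ interchange a b (degree S′ α) (degree S′ β) ⟩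
  (a +ℕ degree S′ α) +ℕ (b +ℕ degree S′ β) ∎
  where
  open ≡-Reasoning
  open CommutativeSemigroupProperties ℕ.+-commutativeSemigroup using (interchange)
  S′ = S ∘ suc

degree≡0 : ∀ {m} S (α : Monomial m) → (∀ e → S e ≡ true → lookup α e ≡ 0) → degree S α ≡ 0
degree≡0 S []      zeros = refl
degree≡0 S (a ∷ α) zeros with S zero in eq
... | false = degree≡0 (S ∘ suc) α (zeros ∘ suc)
... | true  = cong₂ _+ℕ_ (zeros zero eq) (degree≡0 (S ∘ suc) α (zeros ∘ suc))

degree≡0⁻ : ∀ {m} S (α : Monomial m) → degree S α ≡ 0 → ∀ e → S e ≡ true → lookup α e ≡ 0
degree≡0⁻ S (a ∷ α) eq zero    Se rewrite Se = ℕ.m+n≡0⇒m≡0 a eq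
degree≡0⁻ S (a ∷ α) eq (suc e) Se = degree≡0⁻ (S ∘ suc) α (ℕ.m+n≡0⇒n≡0 (if S zero then a else 0) eq) e Se

degree≤1 : ∀ {m} S (α : Monomial m) → (∀ e → lookup α e ≤ℕ 1) →
           (∀ e f → S e ≡ true → S f ≡ true → lookup α e ≢ 0 → lookup α f ≢ 0 → e ≡ f) →
           degree S α ≤ℕ 1
degree≤1 S []      small unique = z≤n
degree≤1 S (a ∷ α) small unique with S zero in eq | a
... | false | _     = degree≤1 (S ∘ suc) α (small ∘ suc) λ e f Se Sf ne ne′ →
  suc-injective (unique (suc e) (suc f) Se Sf ne ne′)
... | true  | zero  = degree≤1 (S ∘ suc) α (small ∘ suc) λ e f Se Sf ne ne′ →
  suc-injective (unique (suc e) (suc f) Se Sf ne ne′)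
... | true  | suc b = ℕ.≤-trans (ℕ.≤-reflexive (trans (cong (suc b +ℕ_) rest) (ℕ.+-identityʳ (suc b))))
  (small zero)
  where
  rest : degree (S ∘ suc) α ≡ 0
  rest = degree≡0 (S ∘ suc) α λ e Se → decidable-stable (lookup α e ℕ.≟ 0) λ ne →
    contradiction (unique zero (suc e) eq Se (λ ()) ne) λ ()

_≤ˡ_ : ∀ {m n} → Vec ℕ m → Vec ℕ n → Set
_≤ˡ_ = Lex.Lex-≤ _≡_ _<ℕ_

-- At the first position where either summand drops strictly, the sum drops strictly as well.
≤ˡ-⊕ : ∀ {m} {α α′ β β′ : Monomial m} → α′ ≤ˡ α → β′ ≤ˡ β → α′ ⊕ β′ ≡ α ⊕ β → α′ ≡ α
≤ˡ-⊕ (Lex.base _)    (Lex.base _)    eq = refl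
≤ˡ-⊕ (Lex.this a< _) (Lex.this b< _) eq = contradiction (cong head eq) (ℕ.<⇒≢ (ℕ.+-mono-< a< b<))
≤ˡ-⊕ (Lex.this a< _) (Lex.next refl _) eq = contradiction (cong head eq) (ℕ.<⇒≢ (ℕ.+-monoˡ-< _ a<))
≤ˡ-⊕ (Lex.next refl _) (Lex.this b< _) eq = contradiction (cong head eq) (ℕ.<⇒≢ (ℕ.+-monoʳ-< _ b<))
≤ˡ-⊕ (Lex.next refl α≤) (Lex.next refl β≤) eq = cong (_ ∷_) (≤ˡ-⊕ α≤ β≤ (cong tail eq))

module _ {m : ℕ} (S : Fin m → Bool) where

  -- Comparing the monomial itself breaks ties in degree, which makes leading terms unique.
  key : Monomial m → Vec ℕ (suc m)
  key α = degree S α ∷ α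

  degree-≤ : ∀ {α β} → key α ≤ˡ key β → degree S α ≤ℕ degree S β
  degree-≤ (Lex.this d< _)    = ℕ.<⇒≤ d<
  degree-≤ (Lex.next d≡ _)    = ℕ.≤-reflexive d≡

  maximal-support : ∀ p {α₀} → Support p α₀ → ∃ λ α → Support p α × (∀ {β} → Support p β → key β ≤ˡ key α)
  maximal-support p {α₀} s₀ =
    argmax key α₀ xs ,
    argmax-all key s₀ (All.all-filter (support? p) (map proj₂ p)) ,
    λ s → All.lookup (f[xs]≤f[argmax] {f = key} α₀ xs) (∈-filter⁺ (support? p) (support-∈ p s) s)
    where
    open Extrema (lexOrder (suc m))
    xs = filter (support? p) (map proj₂ p)

  -- The monomials of `p` and `q` with maximal keys multiply to an uncancelled monomial of `k`, of
  -- degree at most 1. One of the two maximal degrees is therefore 0, and it bounds all degrees in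
  -- its factor.
  factor-degree : ∀ k p q {α₀ β₀} → Support p α₀ → Support q β₀ → k ≈ₚ p *ₚ q →
                  (∀ {γ} → Support k γ → degree S γ ≤ℕ 1) →
                  (∀ {β} → Support q β → degree S β ≡ 0) ⊎ (∀ {α} → Support p α → degree S α ≡ 0)
  factor-degree k p q sα₀ sβ₀ k≈pq small with maximal-support p sα₀ | maximal-support q sβ₀
  ... | α , sα , maxα | β , sβ , maxβ = split (degree S α) (degree S β) refl refl
          (subst (_≤ℕ 1) (degree-⊕ S α β) (small (subst (_≢ 0ℚ) (sym (k≈pq (α ⊕ β)))
            (support-*⁺ p q sα sβ λ {α′} {β′} sα′ sβ′ eq → cong tail
              -- Degrees are additive, so keys add like monomials and `≤ˡ-⊕` applies to the keys
              -- themselves.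
              (≤ˡ-⊕ (maxα sα′) (maxβ sβ′) (cong₂ _∷_
                (trans (sym (degree-⊕ S α′ β′)) (trans (cong (degree S) eq) (degree-⊕ S α β))) eq))))))
    where
    split : ∀ a b → degree S α ≡ a → degree S β ≡ b → a +ℕ b ≤ℕ 1 →
            (∀ {β} → Support q β → degree S β ≡ 0) ⊎ (∀ {α} → Support p α → degree S α ≡ 0)
    split zero    b       a≡ b≡ _  = inj₂ λ s → ℕ.n≤0⇒n≡0 (subst (_ ≤ℕ_) a≡ (degree-≤ (maxα s)))
    split (suc a) zero    a≡ b≡ _  = inj₁ λ s → ℕ.n≤0⇒n≡0 (subst (_ ≤ℕ_) b≡ (degree-≤ (maxβ s)))
    split (suc a) (suc b) a≡ b≡ le = contradiction (subst (_≤ℕ 0) (ℕ.+-suc a b) (s≤s⁻¹ le)) λ ()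

-- Mixed cycles under the exchange property

last-split : ∀ {A : Set} {P : Pred A 0ℓ} → (∀ x → Dec (P x)) → ∀ {xs} → Any P xs →
             ∃ λ as → ∃ λ x → ∃ λ bs → xs ≡ as ++ x ∷ bs × P x × ¬ Any P bs
last-split P? {x ∷ xs} p with Any.any? P? xs
... | yes later =
  let as , y , bs , eq , rest = last-split P? later in x ∷ as , y , bs , cong (x ∷_) eq , rest
last-split P? {x ∷ xs} (here px)     | no none = [] , x , xs , refl , px , none
last-split P? {x ∷ xs} (there later) | no none = contradiction later none

-- Used to cut a cycle open at `x`: what remains is traversed as `bs` followed by `as`.
unique-split : ∀ {A : Set} (as : List A) {x bs} → Unique (as ++ x ∷ bs) →
               Unique (bs ++ as) × x ∉ as × x ∉ bs
unique-split [] (x∉ ∷ un) = subst Unique (sym (++-identityʳ _)) un , (λ ()) , λ x∈ → All.lookup x∉ x∈ refl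
unique-split (a ∷ as) {x} {bs} (a∉ ∷ un) =
  let un′ , x∉as , x∉bs = unique-split as un in
  insert bs un′ (All.++⁺ (All.tail (All.++⁻ʳ as a∉)) (All.++⁻ˡ as a∉)) ,
  (λ { (here x≡a) → All.lookup a∉ (∈-++⁺ʳ as (here refl)) (sym x≡a) ; (there x∈) → x∉as x∈ }) ,
  x∉bs
  where
  insert : ∀ {A : Set} {a : A} ys {zs} → Unique (ys ++ zs) → All (a ≢_) (ys ++ zs) →
           Unique (ys ++ a ∷ zs)
  insert []       un         a∉         = a∉ ∷ un
  insert (y ∷ ys) (y∉ ∷ un) (a≢y ∷ a∉) =
    All.++⁺ (All.++⁻ˡ ys y∉) (a≢y ∘ sym ∷ All.++⁻ʳ ys y∉) ∷ insert ys un a∉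

module _ (G : Digraph) where
  open Digraph G
  open DecMembership (_≟ᶠ_ {order}) using (_∈?_)
  open DecMembership (_≟ᶠ_ {size}) using () renaming (_∈?_ to _∈ᵉ?_)

  -- Paths and exits from a vertex set

  module _ {R : Pred Edge 0ℓ} where

    path-++ : ∀ {u w z} es {fs} → IsPath R u w es → IsPath R w z fs → IsPath R u z (es ++ fs)
    path-++ []       refl         q = q
    path-++ (e ∷ es) (r , eq , p) q = r , eq , path-++ es p q

    path-split : ∀ {u w} es {e fs} → IsPath R u w (es ++ e ∷ fs) →
                 IsPath R u (source e) es × R e × IsPath R (target e) w fs
    path-split []       (r , eq , p) = sym eq , r , p
    path-split (f ∷ es) (r , eq , p) =
      let q , r′ , q′ = path-split es p in (r , eq , q) , r′ , q′

    path-edges : ∀ {u w} es → IsPath R u w es → All R es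
    path-edges []       p           = []
    path-edges (e ∷ es) (r , _ , p) = r ∷ path-edges es p

    path-restrict : ∀ {Q : Pred Edge 0ℓ} {u w es} → All Q es → IsPath R u w es → IsPath Q u w es
    path-restrict []       p            = p
    path-restrict (q ∷ qs) (_ , eq , p) = q , eq , path-restrict qs p

    path-map : ∀ {Q : Pred Edge 0ℓ} {u w} → (∀ {e} → R e → Q e) → ∀ es →
               IsPath R u w es → IsPath Q u w es
    path-map R⊆Q es p = path-restrict (All.map R⊆Q (path-edges es p)) p

    path-end : ∀ {u w} es → u ≢ w → IsPath R u w es → w ∈ map target es
    path-end []            u≢w p           = contradiction p u≢w
    path-end (e ∷ es)      u≢w (_ , _ , p) with target e ≟ᶠ _
    ... | yes eq = here (sym eq)
    ... | no neq = there (path-end es neq p)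

  Avoids : List Vertex → Pred Edge 0ℓ
  Avoids S e = target e ∉ S

  Exit : List Vertex → Pred Edge 0ℓ
  Exit S e = source e ∈ S × target e ∉ S

  exit? : ∀ S e → Dec (Exit S e)
  exit? S e = source e ∈? S ×-dec ¬? (target e ∈? S)

  -- The path is scanned from its end, keeping a stretch that stays outside `S`. Since the path
  -- starts in `S`, this stretch must be preceded by an exit.
  last-exit : ∀ {R : Pred Edge 0ℓ} {u w} S es → IsPath R u w es → u ∈ S → w ∉ S →
              ∃ λ g → R g × Exit S g × Reachable (λ e → R e × Avoids S e) (target g) w
  last-exit {R} S es p u∈ w∉ with scan es p w∉
    where
    scan : ∀ {u w} es → IsPath R u w es → w ∉ S →
           (u ∉ S × Reachable (λ e → R e × Avoids S e) u w) ⊎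
           ∃ λ g → R g × Exit S g × Reachable (λ e → R e × Avoids S e) (target g) w
    scan [] p w∉ = inj₁ (subst (_∉ S) (sym p) w∉ , [] , p)
    scan {u} (e ∷ es) (r , refl , p) w∉ with scan es p w∉
    ... | inj₂ found           = inj₂ found
    ... | inj₁ (e∉ , fs , q) with source e ∈? S
    ...   | yes e∈ = inj₂ (e , r , (e∈ , e∉) , fs , q)
    ...   | no u∉  = inj₁ (u∉ , e ∷ fs , (r , e∉) , refl , q)
  ... | inj₁ (u∉ , _) = contradiction u∈ u∉
  ... | inj₂ found    = found

  -- Appending the closed walk to the path from the root to `u` would give a second such path.
  arborescence-acyclic : ∀ {A e es u} → IsArborescence A → ¬ IsPath (_∈ˢ A) u u (e ∷ es)
  arborescence-acyclic {u = u} (r , arb) cycle with arb u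
  ... | fs , p , unique with ++-identityʳ-unique fs (unique (path-++ fs p cycle))
  ... | ()

  Exchange : (Vertex → Bool) → Set
  Exchange cls = ∀ {A B} → IsArborescence A → IsArborescence B → ∃ λ C → IsArborescence C ×
    (∀ e → (cls (target e) ≡ true → e ∈ˢ A → e ∈ˢ C) × (cls (target e) ≡ false → e ∈ˢ B → e ∈ˢ C))

  -- Trees grown from the root and their extension to arborescences

  module _ (v : Vertex) where

    -- Vertices and edges are listed newest first. Each new edge enters a new vertex, so distinct
    -- edges have distinct targets.
    data Tree : List Vertex → List Edge → Set where
      root : Tree [ v ] []
      grow : ∀ {S es e} → Tree S es → Exit S e → Tree (target e ∷ S) (e ∷ es)

    tree-root : ∀ {S es} → Tree S es → v ∈ S
    tree-root root       = here refl
    tree-root (grow t _) = there (tree-root t)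

    tree-unique : ∀ {S es} → Tree S es → Unique S
    tree-unique root             = [] ∷ []
    tree-unique (grow t (_ , n)) = All.¬Any⇒All¬ _ n ∷ tree-unique t

    tree-target : ∀ {S es e} → Tree S es → e ∈ es → target e ∈ S
    tree-target (grow t _) (here refl) = here refl
    tree-target (grow t _) (there e∈)  = there (tree-target t e∈)

    tree-injective : ∀ {S es e f} → Tree S es → e ∈ es → f ∈ es → target e ≡ target f → e ≡ f
    tree-injective (grow t _) (here refl) (here refl) eq = refl
    tree-injective (grow t (_ , n)) (here refl) (there f∈) eq =
      contradiction (subst (_∈ _) (sym eq) (tree-target t f∈)) n
    tree-injective (grow t (_ , n)) (there e∈) (here refl) eq =
      contradiction (subst (_∈ _) eq (tree-target t e∈)) n
    tree-injective (grow t _) (there e∈) (there f∈) eq = tree-injective t e∈ f∈ eq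

    tree-reach : ∀ {S es w} → Tree S es → w ∈ S → Reachable (_∈ es) v w
    tree-reach root (here refl) = [] , refl
    tree-reach (grow {e = e} t (s∈ , _)) (here refl) =
      let fs , p = tree-reach t s∈ in
      _ , snoc-path fs e (path-map there fs p) (here refl)
    tree-reach (grow t _) (there w∈) =
      let fs , p = tree-reach t w∈ in fs , path-map there fs p

    -- As the targets are distinct and outside `S`, each edge of the path is still an exit once its
    -- predecessors have been added.
    grow-path : ∀ {R S es u w} ps → Tree S es → u ∈ S → IsPath R u w ps →
                Unique (map target ps) → All (Avoids S) ps →
                ∃ λ S′ → ∃ λ es′ → Tree S′ es′ × es ⊆ es′ × ps ⊆ es′
    grow-path [] t u∈ p un av = _ , _ , t , id , λ ()
    grow-path (e ∷ ps) t u∈ (_ , refl , p) (e∉ ∷ un) (a ∷ av) =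
      let S′ , es′ , t′ , sub , sub′ = grow-path ps (grow t (u∈ , a)) (here refl) p un
            (All.zipWith (λ { (n , m) (here eq) → n (sym eq) ; (n , m) (there i) → m i })
              (All.map⁻ e∉ , av))
      in S′ , es′ , t′ , sub ∘ there , λ { (here refl) → sub (here refl) ; (there i) → sub′ i }

    module _ (rooted : RootedAt v) where

      tree-length : ∀ {S es} → Tree S es → length S ≤ℕ order
      tree-length = unique⇒length≤ ∘ tree-unique

      -- A path from `v` to a missing vertex leaves the tree by an exit, which can be added. The
      -- counter `k` is one more than the number of missing vertices; at zero the tree would have
      -- more than `order` distinct vertices.
      spanning-⊇ : ∀ k {S es} → Tree S es → k +ℕ length S ≡ suc order →
                   ∃ λ S′ → ∃ λ es′ → Tree S′ es′ × es ⊆ es′ × (∀ w → w ∈ S′)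
      spanning-⊇ zero    t eq = contradiction (subst (_≤ℕ order) eq (tree-length t)) (ℕ.<-irrefl refl)
      spanning-⊇ (suc k) {S} t eq with any? (λ w → ¬? (w ∈? S))
      ... | no none = _ , _ , t , id , λ w → decidable-stable (w ∈? S) (λ w∉ → none (w , w∉))
      ... | yes (w , w∉) =
        let es , p            = proj₂ rooted w (λ { refl → w∉ (tree-root t) })
            g , _ , exit , _  = last-exit S es p (tree-root t) w∉
            _ , _ , t′ , sub , full = spanning-⊇ k (grow {e = g} t exit) (trans (ℕ.+-suc k _) eq)
        in _ , _ , t′ , sub ∘ there , full

      arborescence-⊇ : ∀ {S es} → Tree S es → ∃ λ A → IsArborescence A × (∀ {e} → e ∈ es → e ∈ˢ A)
      arborescence-⊇ {S} t =
        let _ , es , t′ , sub , full =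
              spanning-⊇ (suc order ∸ length S) t (ℕ.m∸n+n≡m (ℕ.m≤n⇒m≤1+n (tree-length t)))
        in edgeSet es , (v , local⇒arborescence (edgeSet es)
             ( (λ w → let fs , p = tree-reach t′ (full w) in
                      fs , path-map (∈-edgeSet⁺ {es}) fs p)
             , (λ e _ → proj₁ rooted e)
             , λ e f e∈ f∈ → tree-injective t′ (∈-edgeSet⁻ e∈) (∈-edgeSet⁻ f∈)))
           , ∈-edgeSet⁺ ∘ sub
        where
        edgeSet : List Edge → Subset size
        edgeSet es = tabulate (λ e → does (e ∈ᵉ? es))

        ∈-edgeSet⁺ : ∀ {es e} → e ∈ es → e ∈ˢ edgeSet es
        ∈-edgeSet⁺ {es} {e} e∈ =
          lookup⇒[]= e _ (trans (lookup∘tabulate _ e) (dec-true (e ∈ᵉ? es) e∈))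

        ∈-edgeSet⁻ : ∀ {es e} → e ∈ˢ edgeSet es → e ∈ es
        ∈-edgeSet⁻ {es} {e} e∈
          with e ∈ᵉ? es | trans (sym (lookup∘tabulate (λ e → does (e ∈ᵉ? es)) e)) ([]=⇒lookup e∈)
        ... | yes e∈es | _ = e∈es
        ... | no _     | ()

      -- Enter the cycle along `g` and follow it all the way round, stopping before the edge that
      -- would return to `target g`. The resulting tree extends to an arborescence.
      cycle-minus-edge : ∀ {S es g u} cs → Tree S es → Exit S g → IsPath (Avoids S) u u cs →
                         Unique (map target cs) → target g ∈ map target cs →
                         ∃ λ A → IsArborescence A ×
                                 (∀ {e} → e ∈ cs → target e ≢ target g → e ∈ˢ A)
      cycle-minus-edge {S} {g = g} cs t exit p un g∈ with ∈-map⁻ target g∈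
      ... | e , e∈ , eq with ∈-∃++ e∈
      ... | as , bs , refl =
        let p₁ , _ , p₂         = path-split as p
            un′ , g∉as , g∉bs   = unique-split (map target as) (subst Unique (map-++ target as (e ∷ bs)) un)
            q                   = path-++ bs p₂ p₁
            other : ∀ {f} → f ∈ bs ++ as → target f ≢ target e
            other = λ f∈ feq → case-∈ f∈ feq g∉as g∉bs
            _ , es′ , t′ , _ , sub = grow-path (bs ++ as) (grow t exit) (here (sym eq)) q
              (subst Unique (sym (map-++ target bs as)) un′)
              (All.tabulate (λ { f∈ (here feq)  → other f∈ (trans feq eq)
                               ; f∈ (there f∈S) → All.lookup (path-edges (bs ++ as) q) f∈ f∈S }))
            A , arb , ⊇ = arborescence-⊇ t′
        in A , arb , λ f∈ ne → ⊇ (sub (move (∈-++⁻ as f∈) (λ feq → ne (trans feq (sym eq)))))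
        where
        case-∈ : ∀ {f} → f ∈ bs ++ as → target f ≡ target e → target e ∉ map target as →
                 target e ∉ map target bs → ⊥
        case-∈ f∈ feq ∉as ∉bs with ∈-++⁻ bs f∈
        ... | inj₁ i = ∉bs (subst (_∈ map target bs) feq (∈-map⁺ target i))
        ... | inj₂ i = ∉as (subst (_∈ map target as) feq (∈-map⁺ target i))

        move : ∀ {f} → f ∈ as ⊎ f ∈ e ∷ bs → target f ≢ target e → f ∈ bs ++ as
        move (inj₁ i)           ne = ∈-++⁺ʳ bs i
        move (inj₂ (here refl)) ne = contradiction refl ne
        move (inj₂ (there i))   ne = ∈-++⁺ˡ i

      -- Excluding mixed cycles outside a growing tree

      module _ (undominated : ∀ u → ¬ NonTrivialDominator v u)
               (cls : Vertex → Bool) (exchange : Exchange cls) where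

        -- A closed walk outside S through vertices of both classes.
        MixedCycle : List Vertex → Set
        MixedCycle S = ∃ λ d → cls (source d) ≢ cls (target d) × Avoids S d ×
                               Reachable (Avoids S) (target d) (source d)

        -- Without such a path `u` would dominate `w`, a vertex other than itself. The double
        -- negation is harmless because it is only used to derive contradictions.
        ¬¬-bypass : ∀ {u w} → u ≢ v → u ≢ w →
                    ¬ ¬ Reachable (λ e → target e ≢ u) v w
        ¬¬-bypass {u} {w} u≢v u≢w none =
          undominated u (u≢v , λ (sub , _) → u≢w (sub dominated))
          where
          dominated : dom v u w
          dominated es p = decidable-stable (u ∈? vertices v es) λ u∉ →
            none (es , path-restrict (All.tabulate λ e∈ eq →
                   u∉ (there (subst (_∈ _) eq (∈-map⁺ target e∈)))) p)

        color-change : ∀ {R : Pred Edge 0ℓ} {u w} ps → IsPath R u w ps → cls u ≢ cls w →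
                       ∃ λ as → ∃ λ d → ∃ λ bs → ps ≡ as ++ d ∷ bs × cls (source d) ≢ cls (target d)
        color-change [] refl ne = contradiction refl ne
        color-change (e ∷ ps) (_ , refl , p) ne with cls (source e) Bool.≟ cls (target e)
        ... | no  change = [] , e , ps , refl , change
        ... | yes same   =
          let as , d , bs , eq , change = color-change ps p (ne ∘ trans same) in
          e ∷ as , d , bs , cong (e ∷_) eq , change

        -- Every class-true edge of the cycle survives in an arborescence entering the
        -- cycle at h, every class-false edge in one entering it at g; exchanging the
        -- two reassembles the whole cycle.
        exits-both : ∀ {S es u g h} cs → Tree S es → IsPath (Avoids S) u u cs → Unique (map target cs) →
                     Exit S g → Exit S h → target g ∈ map target cs → target h ∈ map target cs →
                     cls (target g) ≡ true → cls (target h) ≡ false → ⊥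
        exits-both [] t p un eg eh () h∈ cg ch
        exits-both {g = g} {h} cs@(_ ∷ _) t p un eg eh g∈ h∈ cg ch =
          let A , arbA , A⊇ = cycle-minus-edge cs t eh p un h∈
              B , arbB , B⊇ = cycle-minus-edge cs t eg p un g∈
              C , arbC , C⊇ = exchange arbA arbB
          in arborescence-acyclic arbC (path-restrict (All.tabulate (λ {e} e∈ → inC A⊇ B⊇ (C⊇ e) e∈ _ refl)) p)
          where
          inC : ∀ {A B C : Subset size} {e} →
                (∀ {e} → e ∈ cs → target e ≢ target h → e ∈ˢ A) →
                (∀ {e} → e ∈ cs → target e ≢ target g → e ∈ˢ B) →
                (cls (target e) ≡ true → e ∈ˢ A → e ∈ˢ C) × (cls (target e) ≡ false → e ∈ˢ B → e ∈ˢ C) →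
                e ∈ cs → ∀ b → cls (target e) ≡ b → e ∈ˢ C
          inC A⊇ B⊇ (fromA , fromB) e∈ true ce =
            fromA ce (A⊇ e∈ (λ eq → contradiction (trans (sym ce) (trans (cong cls eq) ch)) λ ()))
          inC A⊇ B⊇ (fromA , fromB) e∈ false ce =
            fromB ce (B⊇ e∈ (λ eq → contradiction (trans (sym ce) (trans (cong cls eq) cg)) λ ()))

        -- Let u be the last exit target met on the cycle starting from y. A path from v
        -- to y avoiding u leaves S at a vertex met on the cycle before u, so following
        -- the cycle from y to that vertex and then the path back to y avoids u.
        exits-same : ∀ {S c y} cs → v ∈ S → y ∉ S → IsPath (Avoids S) y y cs → Unique (map target cs) →
                     (∀ {g} → Exit S g → target g ∈ map target cs) →
                     (∀ {g} → Exit S g → cls (target g) ≡ c) → cls y ≢ c →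
                     ¬ ¬ ∃ λ g → Exit S g × MixedCycle (target g ∷ S)
        exits-same {S} {c} {y} cs v∈ y∉ p un on-cycle color y≢c none =
          let es₀ , p₀          = proj₂ rooted y (λ { refl → y∉ v∈ })
              g₀ , _ , exit₀ , _ = last-exit S es₀ p₀ v∈ y∉
              e₀ , e₀∈ , eq₀    = ∈-map⁻ target (on-cycle exit₀)
          in bypass (last-split entry? (lose e₀∈ (g₀ , exit₀ , eq₀)))
          where
          Entry : Pred Edge 0ℓ
          Entry e = ∃ λ g → Exit S g × target g ≡ target e

          entry? : ∀ e → Dec (Entry e)
          entry? e = any? (λ g → exit? S g ×-dec (target g ≟ᶠ target e))

          bypass : ¬ ∃ λ as → ∃ λ e → ∃ λ bs → cs ≡ as ++ e ∷ bs × Entry e × ¬ Any Entry bs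
          bypass (as , e₁ , bs , refl , (g₁ , exit₁ , eq₁) , last) =
            -- `u` is not `v` because `v` lies in `S`, and not `y` because all exit targets have
            -- class `c` while `y` has not.
            ¬¬-bypass {u} {y} (λ { refl → proj₂ exit₁ v∈ }) (λ { refl → y≢c (color exit₁) }) avoid
            where
            u : Vertex
            u = target g₁

            u∉as : u ∉ map target as
            u∉as = subst (_∉ map target as) (sym eq₁)
              (proj₁ (proj₂ (unique-split (map target as)
                (subst Unique (map-++ target as (e₁ ∷ bs)) un))))

            avoids : ∀ {e} → target e ≢ u → Avoids S e → Avoids (u ∷ S) e
            avoids ne e∉ (here eq)  = ne eq
            avoids ne e∉ (there e∈) = e∉ e∈

            p₁ : IsPath (Avoids (u ∷ S)) y (source e₁) as
            p₁ = let q , _ = path-split as p in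
              path-restrict (All.tabulate λ {e} e∈ → avoids {e}
                (λ eq → u∉as (subst (_∈ map target as) eq (∈-map⁺ target e∈)))
                (All.lookup (path-edges as q) e∈)) q

            entry-before : ∀ {g} → Exit S g → target g ≢ u → target g ∈ map target as
            entry-before {g} exit ne with ∈-map⁻ target (on-cycle exit)
            ... | e , e∈ , eq with ∈-++⁻ as e∈
            ...   | inj₁ i           = subst (_∈ map target as) (sym eq) (∈-map⁺ target i)
            ...   | inj₂ (here refl) = contradiction (trans eq (sym eq₁)) ne
            ...   | inj₂ (there i)   = contradiction (lose i (g , exit , eq)) last

            -- The vertices `y` and `target g` differ in class, so some edge `d` on the cycle
            -- segment between them changes class. The closed walk is then rotated to start with
            -- `d`.
            mixed : ∀ {g} → Exit S g → target g ∈ map target as →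
                    Reachable (Avoids (u ∷ S)) (target g) y → MixedCycle (u ∷ S)
            mixed {g} exit g∈ (qs , q) with ∈-map⁻ target g∈
            ... | e , e∈ , eq with ∈-∃++ e∈
            ... | as₁ , as₂ , refl with path-split as₁ p₁
            ... | r , av , _ with snoc-path as₁ e r av
            ... | r′ with color-change (as₁ ∷ʳ e) r′
                   (λ same → y≢c (trans same (trans (cong cls (sym eq)) (color exit))))
            ... | l , d , m , split , change with path-split l (subst (IsPath (Avoids (u ∷ S)) _ _) split r′)
            ... | to-d , d∉ , from-d =
              d , change , d∉ , _ ,
              path-++ m from-d (path-++ qs (subst (λ w → IsPath (Avoids (u ∷ S)) w y qs) eq q) to-d)

            avoid : ¬ Reachable (λ e → target e ≢ u) v y
            avoid (qs , q) =
              let g , ne , exit , rs , r = last-exit S qs q v∈ y∉ in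
              none (g₁ , exit₁ , mixed exit (entry-before exit ne)
                     (rs , path-map (λ {e} (e≢ , e∉) → avoids {e} e≢ e∉) rs r))

        -- Induction on the number of vertices outside `S`. For a simple mixed cycle, an exit
        -- missing it could be added to the tree without destroying it, so all exits lead onto it.
        -- They share one class by `exits-both`, and `exits-same` then yields a larger tree that
        -- still leaves a mixed cycle.
        no-mixed-cycle : ∀ k {S es} → Tree S es → k +ℕ length S ≡ suc order → ¬ MixedCycle S
        no-mixed-cycle zero t eq _ = contradiction (subst (_≤ℕ order) eq (tree-length t)) (ℕ.<-irrefl refl)
        no-mixed-cycle (suc k) {S} t eq (d , mixed , d∉ , ps , p) with simple-path ps p
        ... | fs , q , un =
          first-exit (last-exit S _ (proj₂ (proj₂ rooted (source d) (λ { refl → s∉ v∈ }))) v∈ s∉)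
          where
          v∈ : v ∈ S
          v∈ = tree-root t

          smaller : ∀ {g} → Exit S g → ¬ MixedCycle (target g ∷ S)
          smaller exit = no-mixed-cycle k (grow t exit) (trans (ℕ.+-suc k _) eq)

          s∉ : source d ∉ S
          -- The ends of `d` differ in class, so they are distinct and `source d` is entered by an
          -- edge of `fs`, which avoids `S`.
          s∉ s∈ with ∈-map⁻ target (path-end fs (λ same → mixed (cong cls (sym same))) q)
          ... | f , f∈ , feq = All.lookup (path-edges fs q) f∈ (subst (_∈ S) feq s∈)

          cycle : IsPath (Avoids S) (source d) (source d) (d ∷ fs)
          cycle = d∉ , refl , q

          cycle′ : IsPath (Avoids S) (target d) (target d) (fs ∷ʳ d)
          cycle′ = snoc-path fs d q d∉

          on-cycle : ∀ {g} → Exit S g → target g ∈ map target (d ∷ fs)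
          on-cycle {g} exit = decidable-stable (target g ∈? map target (d ∷ fs)) λ g∉ →
            smaller exit (d , mixed , avoid g∉ (here refl) , fs ,
              path-restrict (All.tabulate (λ f∈ → avoid g∉ (there f∈))) q)
            where
            avoid : ∀ {f} → target g ∉ map target (d ∷ fs) → f ∈ d ∷ fs → Avoids (target g ∷ S) f
            avoid g∉ f∈ (here eq)  = g∉ (subst (_∈ map target (d ∷ fs)) eq (∈-map⁺ target f∈))
            avoid g∉ f∈ (there i) = All.lookup (path-edges (d ∷ fs) cycle) f∈ i

          same-class : ∀ {g h} → Exit S g → Exit S h → cls (target h) ≡ cls (target g)
          same-class {g} {h} eg eh with cls (target g) in cg | cls (target h) in ch
          ... | true  | true  = refl
          ... | false | false = refl
          ... | true  | false = ⊥-elim (exits-both (d ∷ fs) t cycle un eg eh (on-cycle eg) (on-cycle eh) cg ch)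
          ... | false | true  = ⊥-elim (exits-both (d ∷ fs) t cycle un eh eg (on-cycle eh) (on-cycle eg) ch cg)

          first-exit : ∀ {P : Pred Edge 0ℓ} {w} → ¬ ∃ λ g → U g × Exit S g × Reachable P (target g) w
          -- One end of `d` has a class other than that of the exits; the cycle is started there.
          first-exit (g , _ , exit , _) with cls (source d) Bool.≟ cls (target g)
          ... | no ne =
            exits-same (d ∷ fs) v∈ s∉ cycle un on-cycle (same-class exit) ne
              λ (h , eh , m) → smaller eh m
          ... | yes same =
            exits-same (fs ∷ʳ d) v∈ d∉ cycle′
              (subst Unique (sym (map-++ target fs [ d ])) (rotate un))
              (λ {h} eh → rotate-∈ (on-cycle eh)) (same-class exit) (λ eq → mixed (trans same (sym eq)))
              λ (h , eh , m) → smaller eh m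
            where
            rotate : Unique (target d ∷ map target fs) → Unique (map target fs ++ [ target d ])
            rotate (d∉ ∷ un) = AllPairs.++⁺ un ([] ∷ []) (All.map (λ ne → ne ∘ sym ∷ []) d∉)

            rotate-∈ : ∀ {w} → w ∈ map target (d ∷ fs) → w ∈ map target (fs ∷ʳ d)
            rotate-∈ {w} w∈ = subst (w ∈_) (sym (map-++ target fs [ d ])) (swap w∈)
              where
              swap : ∀ {w} → w ∈ target d ∷ map target fs → w ∈ map target fs ++ [ target d ]
              swap (here eq) = ∈-++⁺ʳ _ (here eq)
              swap (there i) = ∈-++⁺ˡ i

        -- Between vertices of different classes a path outside `v` has an edge changing class, and
        -- a return path closes it to a mixed cycle outside the one-vertex tree.
        single-class : InducedStronglyConnected (_≢ v) → ∀ {x y} → x ≢ v → y ≢ v → cls x ≡ cls y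
        single-class strong {x} {y} x≢v y≢v with cls x Bool.≟ cls y
        ... | yes eq = eq
        ... | no ne =
          let ps , p             = strong x y x≢v y≢v
              l , d , m , split , change = color-change ps p ne
              _ , (s≢ , t≢) , _  = path-split l (subst (IsPath _ x y) split p)
              qs , q             = strong (target d) (source d) t≢ s≢
          in ⊥-elim (no-mixed-cycle order root (ℕ.+-comm order 1)
               (d , change , (λ { (here eq) → t≢ eq }) , qs ,
                path-map (λ { (_ , t≢) (here eq) → t≢ eq }) qs q))

-- The monomials of κ

module _ {m : ℕ} where

  coefficient-≥0 : ∀ (p : Polynomial m) {α} → All (λ t → 0ℚ ≤ proj₁ t) p → 0ℚ ≤ coefficient p α
  coefficient-≥0 []            []           = ℚ.≤-refl
  coefficient-≥0 ((c , β) ∷ p) {α} (0≤c ∷ pos) with β ≟ α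
  ... | yes _ = ℚ.+-mono-≤ 0≤c (coefficient-≥0 p pos)
  ... | no _  = ℚ.+-mono-≤ ℚ.≤-refl (coefficient-≥0 p pos)

  -- Non-negative terms cannot cancel a positive one.
  coefficient->0 : ∀ (p : Polynomial m) {c α} → All (λ t → 0ℚ ≤ proj₁ t) p → (c , α) ∈ p → 0ℚ < c →
                   0ℚ < coefficient p α
  coefficient->0 ((c , α) ∷ p) (_ ∷ pos) (here refl) 0<c rewrite dec-true (α ≟ α) refl =
    ℚ.+-mono-<-≤ 0<c (coefficient-≥0 p pos)
  coefficient->0 ((c , β) ∷ p) {α = α} (0≤c ∷ pos) (there t∈) 0<c with β ≟ α
  ... | yes _ = ℚ.+-mono-≤-< 0≤c (coefficient->0 p pos t∈ 0<c)
  ... | no _  = ℚ.+-mono-≤-< ℚ.≤-refl (coefficient->0 p pos t∈ 0<c)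

  unit : Fin m → Monomial m
  unit e = tabulate (λ f → if does (e ≟ᶠ f) then 1 else 0)

  monomial : List (Fin m) → Monomial m
  monomial = foldr (λ e → unit e ⊕_) (replicate m 0)

  product-vars : ∀ es → productₚ (map var es) ≡ [ 1ℚ , monomial es ]
  product-vars []       = refl
  product-vars (e ∷ es) rewrite product-vars es = refl

  lookup-monomial-∉ : ∀ {e} es → e ∉ es → lookup (monomial es) e ≡ 0
  lookup-monomial-∉ {e} []       e∉ = lookup-replicate e 0
  lookup-monomial-∉ {e} (f ∷ es) e∉ =
    trans (lookup-zipWith _+ℕ_ e (unit f) (monomial es)) (cong₂ _+ℕ_
      (trans (lookup∘tabulate _ e) (cong (if_then 1 else 0) (dec-false (f ≟ᶠ e) (e∉ ∘ here ∘ sym))))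
      (lookup-monomial-∉ es (e∉ ∘ there)))

  lookup-monomial-∈ : ∀ {e es} → Unique es → e ∈ es → lookup (monomial es) e ≡ 1
  lookup-monomial-∈ {e} {f ∷ es} (f∉ ∷ un) e∈ with f ≟ᶠ e
  ... | yes refl =
    trans (lookup-zipWith _+ℕ_ e (unit e) (monomial es)) (cong₂ _+ℕ_
      (trans (lookup∘tabulate _ e) (cong (if_then 1 else 0) (dec-true (e ≟ᶠ e) refl)))
      (lookup-monomial-∉ es (λ e∈es → All.lookup f∉ e∈es refl)))
  ... | no f≢e with e∈
  ...   | here e≡f   = contradiction (sym e≡f) f≢e
  ...   | there e∈es =
    trans (lookup-zipWith _+ℕ_ e (unit f) (monomial es)) (cong₂ _+ℕ_
      (trans (lookup∘tabulate _ e) (cong (if_then 1 else 0) (dec-false (f ≟ᶠ e) f≢e)))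
      (lookup-monomial-∈ un e∈es))

  subsetMonomial : Subset m → Monomial m
  subsetMonomial A = monomial (filter (_∈ˢ? A) (allFin m))

  lookup-∈ : ∀ {A e} → e ∈ˢ A → lookup (subsetMonomial A) e ≡ 1
  lookup-∈ {A} {e} e∈ = lookup-monomial-∈ (filter⁺ (_∈ˢ? A) (allFin⁺ m))
    (∈-filter⁺ (_∈ˢ? A) (∈-allFin e) e∈)

  lookup-∉ : ∀ {A e} → e ∉ˢ A → lookup (subsetMonomial A) e ≡ 0
  lookup-∉ {A} e∉ = lookup-monomial-∉ (filter (_∈ˢ? A) (allFin m)) λ e∈ →
    e∉ (proj₂ (∈-filter⁻ (_∈ˢ? A) {xs = allFin m} e∈))

  lookup-≢0 : ∀ {A e} → lookup (subsetMonomial A) e ≢ 0 → e ∈ˢ A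
  lookup-≢0 {A} {e} ne with e ∈ˢ? A
  ... | yes e∈ = e∈
  ... | no e∉  = contradiction (lookup-∉ e∉) ne

  lookup-≤1 : ∀ A e → lookup (subsetMonomial A) e ≤ℕ 1
  lookup-≤1 A e with e ∈ˢ? A
  ... | yes e∈ = ℕ.≤-reflexive (lookup-∈ e∈)
  ... | no e∉  = subst (_≤ℕ 1) (sym (lookup-∉ e∉)) z≤n

  -- The final `const 0ℚ` is the empty sum, which remains in the list as a term with coefficient
  -- zero.
  sum-terms : ∀ As → sumₚ (map (λ A → productₚ (map var (filter (_∈ˢ? A) (allFin m)))) As) ≡
                     map (λ A → 1ℚ , subsetMonomial A) As ++ const 0ℚ
  sum-terms []       = refl
  sum-terms (A ∷ As) = cong₂ _++_ (product-vars (filter (_∈ˢ? A) (allFin m))) (sum-terms As)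

module _ {A B : Set} where

  isLeft : A ⊎ B → Bool
  isLeft (inj₁ _) = true
  isLeft (inj₂ _) = false

  fromLeft : (s : A ⊎ B) → isLeft s ≡ true → A
  fromLeft (inj₁ a) _ = a

  fromRight : (s : A ⊎ B) → isLeft s ≡ false → B
  fromRight (inj₂ b) _ = b

∈-subsets : ∀ {m} (A : Subset m) → A ∈ subsets m
∈-subsets []            = here refl
∈-subsets (outside ∷ A) = ∈-++⁺ˡ (∈-map⁺ (outside ∷_) (∈-subsets A))
∈-subsets (inside ∷ A)  = ∈-++⁺ʳ _ (∈-map⁺ (inside ∷_) (∈-subsets A))

module _ (G : Digraph) where
  open Digraph G

  κ-terms : Polynomial size
  κ-terms = map (λ A → 1ℚ , subsetMonomial A) (arborescences G) ++ const 0ℚ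

  κ≡terms : κ G ≡ κ-terms
  κ≡terms = sum-terms (arborescences G)

  support-κ⁺ : ∀ {A} → IsArborescence A → Support (κ G) (subsetMonomial A)
  support-κ⁺ {A} arb rewrite κ≡terms = ℚ.<⇒≢ (coefficient->0 κ-terms
      (All.++⁺ (All.map⁺ (All.universal (λ _ → from-yes (0ℚ ℚ.≤? 1ℚ)) (arborescences G))) (ℚ.≤-refl ∷ []))
      (∈-++⁺ˡ (∈-map⁺ _ (∈-filter⁺ isArborescence? (∈-subsets A) arb)))
      (from-yes (0ℚ ℚ.<? 1ℚ))) ∘ sym

  support-κ⁻ : ∀ {γ} → Support (κ G) γ → ∃ λ A → IsArborescence A × γ ≡ subsetMonomial A
  support-κ⁻ {γ} s with support-term κ-terms (subst (λ k → Support k γ) κ≡terms s)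
  ... | c , c≢0 , c∈ with ∈-++⁻ (map (λ A → 1ℚ , subsetMonomial A) (arborescences G)) c∈
  ...   | inj₂ (here refl) = contradiction refl c≢0
  ...   | inj₁ c∈′ with ∈-map⁻ _ c∈′
  ...     | A , A∈ , refl = A , proj₂ (∈-filter⁻ isArborescence? {xs = subsets size} A∈) , refl

  entering : Vertex → Edge → Bool
  entering w e = does (target e ≟ᶠ w)

  entering⁻ : ∀ {w e} → entering w e ≡ true → target e ≡ w
  entering⁻ {w} {e} eq with target e ≟ᶠ w
  ... | yes te≡w = te≡w
  ... | no _     = contradiction eq λ ()

  -- Exchange of arborescences from a factorization

  module _ (k p q : Polynomial size) (k≈pq : k ≈ₚ p *ₚ q)
           (support⁺ : ∀ {A} → IsArborescence A → Support k (subsetMonomial A))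
           (support⁻ : ∀ {γ} → Support k γ → ∃ λ A → IsArborescence A × γ ≡ subsetMonomial A)
           {A₀ : Subset size} (arb₀ : IsArborescence A₀) where

    degree-≤1 : ∀ w {γ} → Support k γ → degree (entering w) γ ≤ℕ 1
    degree-≤1 w s with support⁻ s
    ... | A , (r , arb) , refl =
      let _ , _ , one-in = arborescence⇒local A arb in
      degree≤1 (entering w) (subsetMonomial A) (lookup-≤1 A) λ e f e-in f-in e≢0 f≢0 →
        one-in e f (lookup-≢0 e≢0) (lookup-≢0 f≢0)
          (trans (entering⁻ {w} {e} e-in) (sym (entering⁻ {w} {f} f-in)))

    Free : Polynomial size → Edge → Set
    Free r e = ∀ {α} → Support r α → lookup α e ≡ 0

    Factors : Monomial size → Set
    Factors γ = ∃ λ α → ∃ λ β → Support p α × Support q β × α ⊕ β ≡ γ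

    factors : ∀ {γ} → Support k γ → Factors γ
    factors {γ} s = support-*⁻ p q (s ∘ trans (k≈pq γ))

    separated : ∀ w → (∀ e → target e ≡ w → Free q e) ⊎ (∀ e → target e ≡ w → Free p e)
    separated w =
      -- The arborescence `A₀` shows that neither factor is zero, as `factor-degree` demands.
      let _ , _ , sα , sβ , _ = factors (support⁺ arb₀) in
      Sum.map (free q) (free p) (factor-degree (entering w) k p q sα sβ k≈pq (degree-≤1 w))
      where
      free : ∀ r → (∀ {α} → Support r α → degree (entering w) α ≡ 0) → ∀ e → target e ≡ w → Free r e
      free r degree-0 e te≡w {α} s =
        degree≡0⁻ (entering w) α (degree-0 s) e (dec-true (target e ≟ᶠ w) te≡w)

    -- true: edges entering the vertex do not occur in q; false: they do not occur in p.
    factorOf : Vertex → Bool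
    factorOf w = isLeft (separated w)

    free-q : ∀ e → factorOf (target e) ≡ true → Free q e
    free-q e eq = fromLeft (separated (target e)) eq e refl

    free-p : ∀ e → factorOf (target e) ≡ false → Free p e
    free-p e eq = fromRight (separated (target e)) eq e refl

    lookup-⊕ : ∀ e (α β : Monomial size) → lookup (α ⊕ β) e ≡ lookup α e +ℕ lookup β e
    lookup-⊕ e = lookup-zipWith _+ℕ_ e

    split-p : ∀ {e α β} → factorOf (target e) ≡ true → Support q β → lookup (α ⊕ β) e ≡ lookup α e
    split-p {e} {α} {β} eq sβ = trans (lookup-⊕ e α β)
      (trans (cong (lookup α e +ℕ_) (free-q e eq sβ)) (ℕ.+-identityʳ _))

    split-q : ∀ {e α β} → factorOf (target e) ≡ false → Support p α → lookup (α ⊕ β) e ≡ lookup β e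
    split-q {e} {α} {β} eq sα = trans (lookup-⊕ e α β) (cong (_+ℕ lookup β e) (free-p e eq sα))

    -- Every variable is absent from one of the factors, so the product determines `α` exponent by
    -- exponent and no cancellation occurs.
    support-⊕ : ∀ {α β} → Support p α → Support q β → Support k (α ⊕ β)
    support-⊕ {α} {β} sα sβ = subst (_≢ 0ℚ) (sym (k≈pq (α ⊕ β)))
      (support-*⁺ p q sα sβ λ sα′ sβ′ eq →
        lookup-injective λ e → same sα′ sβ′ eq e (factorOf (target e)) refl)
      where
      same : ∀ {α′ β′} → Support p α′ → Support q β′ → α′ ⊕ β′ ≡ α ⊕ β →
             ∀ e b → factorOf (target e) ≡ b → lookup α′ e ≡ lookup α e
      same {α′} {β′} sα′ sβ′ eq e true class =
        trans (sym (split-p {e} {α′} class sβ′))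
          (trans (cong (λ γ → lookup γ e) eq) (split-p {e} {α} class sβ))
      same sα′ _ _ e false class = trans (free-p e class sα′) (sym (free-p e class sα))

    Swapped : Subset size → Subset size → Subset size → Set
    Swapped A B C = ∀ e → (factorOf (target e) ≡ true  → e ∈ˢ A → e ∈ˢ C) ×
                          (factorOf (target e) ≡ false → e ∈ˢ B → e ∈ˢ C)

    swapped : ∀ {A B C α β α′ β′} → Support p α → Support q β → Support p α′ → Support q β′ →
              α ⊕ β ≡ subsetMonomial A → α′ ⊕ β′ ≡ subsetMonomial B → α ⊕ β′ ≡ subsetMonomial C →
              Swapped A B C
    swapped {A} {B} {C} {α} {β} {α′} {β′} sα sβ sα′ sβ′ A≡ B≡ C≡ e =
      (λ class e∈ → member (begin
        lookup (α ⊕ β′) e            ≡⟨ split-p {e} {α} class sβ′ ⟩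
        lookup α e                   ≡⟨ split-p {e} {α} class sβ ⟨
        lookup (α ⊕ β) e             ≡⟨ cong (λ γ → lookup γ e) A≡ ⟩
        lookup (subsetMonomial A) e  ≡⟨ lookup-∈ e∈ ⟩
        1                            ∎)) ,
      (λ class e∈ → member (begin
        lookup (α ⊕ β′) e            ≡⟨ split-q {e} {α} {β′} class sα ⟩
        lookup β′ e                  ≡⟨ split-q {e} {α′} {β′} class sα′ ⟨
        lookup (α′ ⊕ β′) e           ≡⟨ cong (λ γ → lookup γ e) B≡ ⟩
        lookup (subsetMonomial B) e  ≡⟨ lookup-∈ e∈ ⟩
        1                            ∎))
      where
      open ≡-Reasoning
      member : lookup (α ⊕ β′) e ≡ 1 → e ∈ˢ C
      member one = lookup-≢0 λ eq →
        contradiction (trans (sym one) (trans (cong (λ γ → lookup γ e) C≡) eq)) λ ()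

    -- The part of `A` coming from `p` times the part of `B` coming from `q` is again a monomial of
    -- `k`, hence that of an arborescence.
    recombine : ∀ {A B} → Factors (subsetMonomial A) → Factors (subsetMonomial B) →
                ∃ λ C → IsArborescence C × Swapped A B C
    recombine (α , β , sα , sβ , A≡) (α′ , β′ , sα′ , sβ′ , B≡) =
      let C , arb , C≡ = support⁻ (support-⊕ sα sβ′) in
      C , arb , swapped sα sβ sα′ sβ′ A≡ B≡ C≡

    exchange : Exchange G factorOf
    exchange arbA arbB = recombine (factors (support⁺ arbA)) (factors (support⁺ arbB))

    constant-factor : (∀ e f → factorOf (target e) ≡ factorOf (target f)) →
                      IsConstant p ⊎ IsConstant q
    -- If some edge is free in `q`, then all are and `q` is constant; otherwise, also when there are
    -- no edges, `p` is.
    constant-factor same = decide (any? (λ e → factorOf (target e) Bool.≟ true))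
      where
      decide : Dec (∃ λ e → factorOf (target e) ≡ true) → IsConstant p ⊎ IsConstant q
      decide (yes (f , eq)) = inj₂ (constant q λ s e → free-q e (trans (same e f) eq) s)
      decide (no none)      = inj₁ (constant p λ s e →
        free-p e (Bool.¬-not (λ eq → none (e , eq))) s)

theorem3p5 : (G : Digraph) (v : Digraph.Vertex G) →
    Digraph.RootedAt G v →
    Digraph.InducedStronglyConnected G (λ w → w ≢ v) →
    (∀ u → ¬ Digraph.NonTrivialDominator G v u) →
    IsPrime (κ G)
theorem3p5 G v rooted strong undominated p q κ≈pq =
  let _ , arb , _ = arborescence-⊇ G v rooted root in
  -- Only classes of edge targets are compared, and these differ from `v` since no edge enters the
  -- root.
  constant-factor G (κ G) p q κ≈pq (support-κ⁺ G) (support-κ⁻ G) arb λ e f →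
    single-class G v rooted undominated
      (factorOf G (κ G) p q κ≈pq (support-κ⁺ G) (support-κ⁻ G) arb)
      (exchange G (κ G) p q κ≈pq (support-κ⁺ G) (support-κ⁻ G) arb)
      strong (proj₁ rooted e) (proj₁ rooted f)
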